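{- For all integers $k\ge1$ and $n\ge1$, $$N^{(k-1)(k-2)\cdots1k}_{32\text{ - }1}(n)=\begin{cases}0,&\text{if }k\ge4,\\ B_{n-1}-(n-2)B_{n-3},&\text{if }k=3\text{ and }n\ge3,\\ B_n-(n-1)B_{n-2},&\text{if }k=2\text{ and }n\ge2,\\ B_n,&\text{if }k=1.\end{cases}$$
   Context: A permutation $\pi=\pi_1\cdots\pi_n$ of $\{1,\dots,n\}$ contains the generalized pattern $32\text{ - }1$ if there are indices $i,j$ with $i+1<j\le n$ such that $\pi_i\pi_{i+1}\pi_j$ is order-isomorphic to $321$; otherwise it avoids it. A permutation $\pi$ begins with a pattern $p=p_1\cdots p_k$ if $n\ge k$ and $\pi_1\cdots\pi_k$ is order-isomorphic to $p$. The pattern $(k-1)(k-2)\cdots1k$ consists of $k-1,k-2,\dots,1$ in decreasing order followed by $k$ (for $k=1$ it is $1$, for $k=2$ it is $12$, for $k=3$ it is $213$). $N^p_q(n)$ is the number of permutations of $\{1,\dots,n\}$ that avoid $q$ and begin with $p$. $B_m$ is the $m$th Bell number ($B_0=1$). The formula makes no assertion for $k=3$, $n<3$ or $k=2$, $n<2$. -}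

module Defs where

open import Data.Fin using (Fin; toℕ)
open import Data.Fin.Properties using (any?; all?)
open import Data.List using (List; []; _∷_; [_]; map; concatMap; cartesianProductWith; filter; length; upTo)
open import Data.Nat using (ℕ; zero; suc; _≤_; _<_; _≤?_; _<?_; _≟_)
open import Data.Nat.Properties using (≤-irrelevant)
open import Data.Product using (∃-syntax; Σ-syntax; _×_; _,_)
open import Data.Vec using (Vec; []; _∷_; _∷ʳ_; lookup; truncate)
open import Data.Vec.Relation.Unary.AllPairs using (allPairs?)
open import Data.Vec.Relation.Unary.Unique.Propositional using (Unique)
open import Function.Bundles using (_⇔_; mk⇔; module Equivalence)
open import Relation.Binary.PropositionalEquality using (_≡_; subst)
open import Relation.Nullary using (Dec; yes; no; ¬_)
open import Relation.Nullary.Decidable using (map′; ¬?; _×-dec_; _→-dec_)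

words : {A : Set} → List A → (n : ℕ) → List (Vec A n)
words as zero    = [ [] ]
words as (suc n) = cartesianProductWith _∷_ as (words as n)

unique? : {n : ℕ} (w : Vec ℕ n) → Dec (Unique w)
unique? = allPairs? (λ x y → ¬? (x ≟ y))

-- A permutation of {1,…,n} is represented in one-line notation: a word of
-- length n over the letters 1,…,n without repeated letters.
permutations : (n : ℕ) → List (Vec ℕ n)
permutations n = filter unique? (words (map suc (upTo n)) n)

OrderIsomorphic : {k : ℕ} → Vec ℕ k → Vec ℕ k → Set
OrderIsomorphic {k} u v =
  (i j : Fin k) → lookup u i < lookup u j ⇔ lookup v i < lookup v j

orderIsomorphic? : {k : ℕ} (u v : Vec ℕ k) → Dec (OrderIsomorphic u v)
orderIsomorphic? u v = all? λ i → all? λ j →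
  map′ (λ (f , g) → mk⇔ f g)
       (λ e → Equivalence.to e , Equivalence.from e)
       (((lookup u i <? lookup u j) →-dec (lookup v i <? lookup v j)) ×-dec
        ((lookup v i <? lookup v j) →-dec (lookup u i <? lookup u j)))

BeginsWith : {k n : ℕ} → Vec ℕ k → Vec ℕ n → Set
BeginsWith {k} {n} p π = Σ[ k≤n ∈ k ≤ n ] OrderIsomorphic (truncate k≤n π) p

beginsWith? : {k n : ℕ} (p : Vec ℕ k) (π : Vec ℕ n) → Dec (BeginsWith p π)
beginsWith? {k} {n} p π with k ≤? n
... | no  k≰n = no λ (k≤n , _) → k≰n k≤n
... | yes k≤n = map′ (k≤n ,_)
  (λ (k≤n′ , iso) →
    subst (λ h → OrderIsomorphic (truncate h π) p) (≤-irrelevant k≤n′ k≤n) iso)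
  (orderIsomorphic? (truncate k≤n π) p)

-- In the generalized pattern 32-1 the letters playing the roles of 3 and 2
-- are adjacent (positions i and i′ = i + 1).
Contains32-1 : {n : ℕ} → Vec ℕ n → Set
Contains32-1 {n} π = ∃[ i ] ∃[ i′ ] ∃[ j ]
  toℕ {n} i′ ≡ suc (toℕ {n} i) × toℕ i′ < toℕ {n} j ×
  OrderIsomorphic (lookup π i ∷ lookup π i′ ∷ lookup π j ∷ []) (3 ∷ 2 ∷ 1 ∷ [])

contains32-1? : {n : ℕ} (π : Vec ℕ n) → Dec (Contains32-1 π)
contains32-1? π = any? λ i → any? λ i′ → any? λ j →
  (toℕ i′ ≟ suc (toℕ i)) ×-dec (toℕ i′ <? toℕ j) ×-dec
  orderIsomorphic? (lookup π i ∷ lookup π i′ ∷ lookup π j ∷ []) (3 ∷ 2 ∷ 1 ∷ [])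

Avoids32-1 : {n : ℕ} → Vec ℕ n → Set
Avoids32-1 π = ¬ Contains32-1 π

avoids32-1? : {n : ℕ} (π : Vec ℕ n) → Dec (Avoids32-1 π)
avoids32-1? π = ¬? (contains32-1? π)

-- The number of permutations of {1,…,n} that avoid 32-1 and begin with p.
N : {k : ℕ} → Vec ℕ k → ℕ → ℕ
N p n = length
  (filter (λ π → avoids32-1? π ×-dec beginsWith? p π) (permutations n))

decreasing : (m : ℕ) → Vec ℕ m
decreasing zero    = []
decreasing (suc m) = suc m ∷ decreasing m

-- The pattern (k-1)(k-2)⋯1k for k ≥ 1; the value at k = 0 is a dummy.
leadingPattern : (k : ℕ) → Vec ℕ k
leadingPattern zero    = []
leadingPattern (suc m) = decreasing m ∷ʳ suc m

-- All ways of adding x to a set partition, given as its list of blocks: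
-- to one of the existing blocks, or as a new singleton block.
insertions : {A : Set} → A → List (List A) → List (List (List A))
insertions x []       = [ [ [ x ] ] ]
insertions x (b ∷ bs) = ((x ∷ b) ∷ bs) ∷ map (b ∷_) (insertions x bs)

-- Each set partition of {1,…,n} occurs exactly once in this list.
setPartitions : ℕ → List (List (List ℕ))
setPartitions zero    = [ [] ]
setPartitions (suc n) = concatMap (insertions (suc n)) (setPartitions n)

bell : ℕ → ℕ
bell n = length (setPartitions n)

{-# OPTIONS --safe #-}

-- Cut an avoider of 32-1 at its smallest letter s, as L s R.  A descent in L
-- would form the pattern with s, so L is increasing, and R is an arbitrary
-- avoider of the remaining letters.  Hence the number of avoiders satisfies
-- a(n+1) = Σᵢ (n choose i) a(i), the recurrence of the Bell numbers.  If the
-- word begins with a descent x y, then y = s and L = x, which leaves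
-- (n-1) B(n-2) of the B(n) avoiders to be discarded for the pattern 12.
-- Deleting the letter 1, necessarily in second position, reduces 213 to 12, and
-- for k ≥ 4 the pattern itself contains 32-1.
module Submission where

open import Defs
open import Data.Empty using (⊥; ⊥-elim)
open import Data.Fin using (zero; suc)
open import Data.Integer using (+_; _-_; _*_; _⊖_)
import Data.Integer.Properties as ℤ
open import Data.List using (List; []; [_]; _∷_; _++_; length; map; concatMap; filter; upTo; applyUpTo)
import Data.List.Properties as List
open import Data.List.Membership.Propositional using (_∈_; _∉_; find; lose)
import Data.List.Membership.Propositional.Properties as Mem
open import Data.List.Relation.Binary.Permutation.Propositional
  using (_↭_; prep; ↭-sym; ↭⇒↭ₛ)
  renaming (refl to ↭-refl; trans to ↭-trans; swap to ↭-swap)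
open import Data.List.Relation.Binary.Permutation.Propositional.Properties as Perm
  using (∈-resp-↭; All-resp-↭; ↭-length; shift; drop-∷; ++⁺ˡ)
import Data.List.Relation.Binary.Permutation.Setoid.Properties as PermSetoid
open import Data.List.Relation.Binary.Subset.Propositional using (_⊆_)
open import Data.List.Relation.Ternary.Interleaving.Propositional
  using (Interleaving; []; consˡ; consʳ; toPermutation)
open import Data.List.Relation.Unary.All as All using (All; []; _∷_)
import Data.List.Relation.Unary.All.Properties as All
open import Data.List.Relation.Unary.AllPairs as AllPairs using (AllPairs; []; _∷_)
import Data.List.Relation.Unary.AllPairs.Properties as AllPairs
open import Data.List.Relation.Unary.Any using (here; there)
open import Data.List.Relation.Unary.Unique.Propositional using (Unique)
import Data.List.Relation.Unary.Unique.Propositional.Properties as Unique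
open import Data.Nat using (ℕ; zero; suc; _+_; _∸_; _≤_; _<_; z≤n; s≤s; _<?_)
  renaming (_*_ to _·_)
open import Data.Nat.ListAction using (sum)
open import Data.Nat.ListAction.Properties using (sum-++)
open import Data.Nat.Properties
open import Data.Nat.Tactic.RingSolver using (solve-∀)
open import Data.Product using (∃; ∃₂; _×_; _,_; proj₁; proj₂; map₁; map₂)
open import Data.Sum using (_⊎_; inj₁; inj₂)
open import Data.Unit using (⊤)
open import Data.Vec as Vec using (Vec; []; _∷_; lookup; toList)
import Data.Vec.Properties as Vec
import Data.Vec.Relation.Unary.All.Properties as VecAll
open import Data.Vec.Relation.Unary.AllPairs using ([]; _∷_)
import Data.Vec.Relation.Unary.Unique.Propositional as Vec
open import Function using (_∘_; id)
open import Function.Bundles using (mk⇔; module Equivalence)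
open import Relation.Binary.PropositionalEquality
  using (_≡_; _≢_; refl; sym; trans; cong; cong₂; subst; setoid; module ≡-Reasoning)
open import Relation.Nullary using (¬_; yes; no; contradiction)
open import Relation.Nullary.Decidable using (¬?; _×-dec_; from-yes)
open import Relation.Unary using (Decidable)

private variable
  A B C : Set
  n s x y : ℕ
  L R S w v : List ℕ

-- Lists without repetitions

∈-∷-tail : {a b : A} {xs : List A} → a ≢ b → b ∈ a ∷ xs → b ∈ xs
∈-∷-tail a≢b (here b≡a)   = contradiction (sym b≡a) a≢b
∈-∷-tail _   (there b∈xs) = b∈xs

-- One occurrence of the head is cut out of `ys`. The other elements of `xs` differ from it, so they
-- survive the cut and the induction goes on.
unique-⊆⇒↭ : {xs ys : List A} → Unique xs → xs ⊆ ys → ∃ λ zs → ys ↭ xs ++ zs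
unique-⊆⇒↭ {xs = []}     _          _     = _ , ↭-refl
unique-⊆⇒↭ {xs = x ∷ xs} (x∉ ∷ xs!) xs⊆ys
  with as , bs , refl ← Mem.∈-∃++ (xs⊆ys (here refl))
  with zs , p ← unique-⊆⇒↭ {ys = as ++ bs} xs! (λ y∈xs →
    ∈-∷-tail (All.lookup x∉ y∈xs) (∈-resp-↭ (shift x as bs) (xs⊆ys (there y∈xs))))
  = zs , ↭-trans (shift x as bs) (prep x p)

unique-⊆⇒length≤ : {xs ys : List A} → Unique xs → xs ⊆ ys → length xs ≤ length ys
unique-⊆⇒length≤ {xs = xs} {ys} xs! xs⊆ys with zs , p ← unique-⊆⇒↭ xs! xs⊆ys = begin
  length xs              ≤⟨ m≤m+n _ _ ⟩
  length xs + length zs  ≡⟨ List.length-++ xs ⟨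
  length (xs ++ zs)      ≡⟨ ↭-length p ⟨
  length ys              ∎
  where open ≤-Reasoning

unique-same-members⇒length : {xs ys : List A} → Unique xs → Unique ys →
  xs ⊆ ys → ys ⊆ xs → length xs ≡ length ys
unique-same-members⇒length xs! ys! xs⊆ys ys⊆xs =
  ≤-antisym (unique-⊆⇒length≤ xs! xs⊆ys) (unique-⊆⇒length≤ ys! ys⊆xs)

unique-⊆-length⇒↭ : {xs ys : List A} → Unique xs → xs ⊆ ys → length xs ≡ length ys → xs ↭ ys
unique-⊆-length⇒↭ {xs = xs} {ys} xs! xs⊆ys eq with unique-⊆⇒↭ xs! xs⊆ys
... | []     , p = ↭-sym (subst (ys ↭_) (List.++-identityʳ xs) p)
... | z ∷ zs , p = contradiction length≡ (m≢1+m+n (length xs))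
  where
  length≡ : length xs ≡ suc (length xs + length zs)
  length≡ = trans eq (trans (↭-length p) (trans (List.length-++ xs) (+-suc _ _)))

-- The key `g` tells the pieces apart: a common entry of two pieces forces equal keys, while the
-- keys along `xs` are distinct. Below, the key is the part of a word in front of its smallest
-- letter.
unique-concatMap : (h : A → List B) (g : A → C) (xs : List A) →
  (∀ {a} → a ∈ xs → Unique (h a)) →
  (∀ {a a′ b} → a ∈ xs → a′ ∈ xs → b ∈ h a → b ∈ h a′ → g a ≡ g a′) →
  Unique (map g xs) → Unique (concatMap h xs)
unique-concatMap h g []       _  _    _          = []
unique-concatMap h g (a ∷ xs) h! same (g∉ ∷ gs!) =
  Unique.++⁺ (h! (here refl))
    (unique-concatMap h g xs (h! ∘ there) (λ p q → same (there p) (there q)) gs!)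
    λ (b∈ha , b∈rest) →
      let _ , a′∈xs , b∈ha′ = find (Mem.∈-concatMap⁻ h b∈rest)
      in contradiction (same (here refl) (there a′∈xs) b∈ha b∈ha′)
                       (All.lookup g∉ (Mem.∈-map⁺ g a′∈xs))

length-concatMap : (h : A → List B) (xs : List A) →
  length (concatMap h xs) ≡ sum (map (length ∘ h) xs)
length-concatMap h []       = refl
length-concatMap h (x ∷ xs) =
  trans (List.length-++ (h x)) (cong (_+_ (length (h x))) (length-concatMap h xs))

sum-concatMap : (g : B → ℕ) (h : A → List B) (xs : List A) →
  sum (map g (concatMap h xs)) ≡ sum (map (λ a → sum (map g (h a))) xs)
sum-concatMap g h []       = refl
sum-concatMap g h (a ∷ xs) = begin
  sum (map g (h a ++ concatMap h xs))                   ≡⟨ cong sum (List.map-++ g (h a) _) ⟩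
  sum (map g (h a) ++ map g (concatMap h xs))           ≡⟨ sum-++ (map g (h a)) _ ⟩
  sum (map g (h a)) + sum (map g (concatMap h xs))      ≡⟨ cong (_+_ _) (sum-concatMap g h xs) ⟩
  sum (map g (h a)) + sum (map (λ a → sum (map g (h a))) xs) ∎
  where open ≡-Reasoning

sum-const : (c : ℕ) (xs : List A) → sum (map (λ _ → c) xs) ≡ length xs · c
sum-const c []       = refl
sum-const c (_ ∷ xs) = cong (_+_ _) (sum-const c xs)

length-filter-¬ : {P : A → Set} (P? : Decidable P) (xs : List A) →
  length (filter P? xs) + length (filter (¬? ∘ P?) xs) ≡ length xs
length-filter-¬ P? []       = refl
length-filter-¬ P? (x ∷ xs) with P? x
... | yes _ = cong suc (length-filter-¬ P? xs)
... | no  _ = trans (+-suc _ _) (cong suc (length-filter-¬ P? xs))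

-- The Bell numbers

-- The number of ways of adding m further elements to a set partition with k
-- blocks.
extensions : ℕ → ℕ → ℕ
extensions zero    k = 1
extensions (suc m) k = k · extensions m k + extensions m (suc k)

-- Σᵢ (n choose i) g i
binomialTransform : (ℕ → ℕ) → ℕ → ℕ
binomialTransform g zero    = g zero
binomialTransform g (suc n) = binomialTransform g n + binomialTransform (g ∘ suc) n

binomialTransform-cong : {g h : ℕ → ℕ} → (∀ m → g m ≡ h m) → ∀ n →
  binomialTransform g n ≡ binomialTransform h n
binomialTransform-cong g≗h zero    = g≗h 0
binomialTransform-cong g≗h (suc n) =
  cong₂ _+_ (binomialTransform-cong g≗h n) (binomialTransform-cong (g≗h ∘ suc) n)

-- The recursion of `extensions` in its first argument has the shape `k · g m + h m`, so this
-- carries the transform through it.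
binomialTransform-linear : (k : ℕ) (g h : ℕ → ℕ) (n : ℕ) →
  binomialTransform (λ m → k · g m + h m) n ≡ k · binomialTransform g n + binomialTransform h n
binomialTransform-linear k g h zero    = refl
binomialTransform-linear k g h (suc n) = trans
  (cong₂ _+_ (binomialTransform-linear k g h n) (binomialTransform-linear k (g ∘ suc) (h ∘ suc) n))
  (regroup k (binomialTransform g n) (binomialTransform h n)
             (binomialTransform (g ∘ suc) n) (binomialTransform (h ∘ suc) n))
  where
  regroup : ∀ k a b c d → k · a + b + (k · c + d) ≡ k · (a + c) + (b + d)
  regroup = solve-∀

-- Sort the extensions by the set of elements added to one fixed block.
extensions-suc : ∀ n k → extensions n (suc k) ≡ binomialTransform (λ m → extensions m k) n
extensions-suc zero    k = refl
extensions-suc (suc n) k = begin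
  extensions n (suc k) + k · extensions n (suc k) + extensions n (suc (suc k))
    ≡⟨ +-assoc (extensions n (suc k)) _ _ ⟩
  extensions n (suc k) + (k · extensions n (suc k) + extensions n (suc (suc k)))
    ≡⟨ cong₂ (λ a b → a + (k · a + b)) (extensions-suc n k) (extensions-suc n (suc k)) ⟩
  T (λ m → extensions m k) + (k · T (λ m → extensions m k) + T (λ m → extensions m (suc k)))
    ≡⟨ cong (_+_ (T (λ m → extensions m k)))
         (binomialTransform-linear k (λ m → extensions m k) (λ m → extensions m (suc k)) n) ⟨
  T (λ m → extensions m k) + T (λ m → extensions (suc m) k) ∎
  where
  open ≡-Reasoning
  T : (ℕ → ℕ) → ℕ
  T g = binomialTransform g n

-- Joining one of the `length bs` blocks keeps the number of blocks; exactly one insertion, the new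
-- singleton, raises it by one.
sum-insertions : (g : ℕ → ℕ) (a : A) (bs : List (List A)) →
  sum (map (g ∘ length) (insertions a bs)) ≡ length bs · g (length bs) + g (suc (length bs))
sum-insertions g a []       = +-identityʳ (g 1)
sum-insertions g a (b ∷ bs) = begin
  g (suc l) + sum (map (g ∘ length) (map (b ∷_) (insertions a bs)))
    ≡⟨ cong (λ z → g (suc l) + sum z) (sym (List.map-∘ (insertions a bs))) ⟩
  g (suc l) + sum (map (g ∘ suc ∘ length) (insertions a bs))
    ≡⟨ cong (_+_ (g (suc l))) (sum-insertions (g ∘ suc) a bs) ⟩
  g (suc l) + (l · g (suc l) + g (suc (suc l)))
    ≡⟨ +-assoc (g (suc l)) _ _ ⟨
  suc l · g (suc l) + g (suc (suc l)) ∎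
  where
  open ≡-Reasoning
  l = length bs

-- A set partition of `n + m` elements arises from one of the first `n` by `m` further insertions.
-- The induction moves one insertion at a time from `setPartitions` to `extensions`.
sum-extensions : ∀ n m →
  sum (map (extensions m ∘ length) (setPartitions n)) ≡ extensions (n + m) 0
sum-extensions zero    m = +-identityʳ _
sum-extensions (suc n) m = begin
  sum (map (extensions m ∘ length) (concatMap (insertions (suc n)) (setPartitions n)))
    ≡⟨ sum-concatMap _ (insertions (suc n)) (setPartitions n) ⟩
  sum (map (λ p → sum (map (extensions m ∘ length) (insertions (suc n) p))) (setPartitions n))
    ≡⟨ cong sum (List.map-cong (sum-insertions (extensions m) (suc n)) (setPartitions n)) ⟩
  sum (map (extensions (suc m) ∘ length) (setPartitions n))
    ≡⟨ sum-extensions n (suc m) ⟩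
  extensions (n + suc m) 0
    ≡⟨ cong (λ j → extensions j 0) (+-suc n m) ⟩
  extensions (suc n + m) 0 ∎
  where open ≡-Reasoning

bell≡extensions : ∀ n → bell n ≡ extensions n 0
bell≡extensions n = begin
  length (setPartitions n)                           ≡⟨ *-identityʳ _ ⟨
  length (setPartitions n) · 1                       ≡⟨ sum-const 1 (setPartitions n) ⟨
  sum (map (extensions 0 ∘ length) (setPartitions n)) ≡⟨ sum-extensions n 0 ⟩
  extensions (n + 0) 0                               ≡⟨ cong (λ j → extensions j 0) (+-identityʳ n) ⟩
  extensions n 0                                     ∎
  where open ≡-Reasoning

-- The first element forms a block, so `extensions (suc n) 0` reduces to `extensions n 1`. The
-- elements that stay out of this block form a set partition of their own.
bell-suc : ∀ n → bell (suc n) ≡ binomialTransform bell n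
bell-suc n = begin
  bell (suc n)                                ≡⟨ bell≡extensions (suc n) ⟩
  extensions n 1                              ≡⟨ extensions-suc n 0 ⟩
  binomialTransform (λ m → extensions m 0) n  ≡⟨ binomialTransform-cong bell≡extensions n ⟨
  binomialTransform bell n                    ∎
  where open ≡-Reasoning

-- Increasing lists and their sublists

Increasing : List ℕ → Set
Increasing = AllPairs _<_

increasing⇒unique : Increasing S → Unique S
increasing⇒unique = AllPairs.map <⇒≢

unique-resp-↭ : w ↭ S → Unique w → Unique S
unique-resp-↭ p = PermSetoid.Unique-resp-↭ (setoid ℕ) (↭⇒↭ₛ p)

minimum-∈ : Increasing (s ∷ S) → x ∈ s ∷ S → s ≤ x
minimum-∈ _       (here refl) = ≤-refl
minimum-∈ (s< ∷ _) (there x∈) = <⇒≤ (All.lookup s< x∈)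

splits : List ℕ → List (List ℕ × List ℕ)
splits []      = ([] , []) ∷ []
splits (x ∷ S) = map (map₁ (x ∷_)) (splits S) ++ map (map₂ (x ∷_)) (splits S)

splits⇒interleaving : ∀ S → (L , R) ∈ splits S → Interleaving L R S
splits⇒interleaving []      (here refl) = []
splits⇒interleaving (x ∷ S) LR∈ with Mem.∈-++⁻ (map (map₁ (x ∷_)) (splits S)) LR∈
... | inj₁ ∈ˡ with _ , LR∈′ , refl ← Mem.∈-map⁻ _ ∈ˡ = consˡ (splits⇒interleaving S LR∈′)
... | inj₂ ∈ʳ with _ , LR∈′ , refl ← Mem.∈-map⁻ _ ∈ʳ = consʳ (splits⇒interleaving S LR∈′)

interleaving-all : {P : ℕ → Set} → Interleaving L R S → All P S → All P L × All P R
interleaving-all {L = L} sp = All.++⁻ L ∘ All-resp-↭ (toPermutation sp)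

interleaving-increasing : Interleaving L R S → Increasing S → Increasing L × Increasing R
interleaving-increasing []         _ = [] , []
interleaving-increasing (consˡ sp) (x< ∷ S↑) with L↑ , R↑ ← interleaving-increasing sp S↑ =
  proj₁ (interleaving-all sp x<) ∷ L↑ , R↑
interleaving-increasing (consʳ sp) (x< ∷ S↑) with L↑ , R↑ ← interleaving-increasing sp S↑ =
  L↑ , proj₂ (interleaving-all sp x<) ∷ R↑

interleaving-length : Interleaving L R S → length S ≡ length L + length R
interleaving-length {L = L} sp = trans (↭-length (toPermutation sp)) (List.length-++ L)

interleaving-length≤ : Interleaving L R S → length R ≤ length S
interleaving-length≤ sp = ≤-trans (m≤n+m _ _) (≤-reflexive (sym (interleaving-length sp)))

-- The smallest letter `x` of the set lies in `L` or in `v`. In `L` it can only be the head, because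
-- `L` is increasing; from `v`, whose order is arbitrary, it is cut out and becomes the head of `R`.
splits-complete : ∀ S → Increasing S → Increasing L → S ↭ L ++ v →
  ∃ λ R → (L , R) ∈ splits S × v ↭ R
splits-complete {[]}    []      _ _ p with refl ← Perm.↭-empty-inv (↭-sym p) = [] , here refl , ↭-refl
splits-complete {l ∷ L} []      _ _ p = contradiction (↭-length p) λ ()
splits-complete {L} {v} (x ∷ S) S↑@(_ ∷ S′↑) L↑ p with Mem.∈-++⁻ L (∈-resp-↭ p (here refl))
splits-complete {l ∷ L} (x ∷ S) S↑@(_ ∷ S′↑) (l< ∷ L↑) p | inj₁ (there x∈L) =
  contradiction (All.lookup l< x∈L) (≤⇒≯ (minimum-∈ S↑ (∈-resp-↭ (↭-sym p) (here refl))))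
splits-complete {l ∷ L} (x ∷ S) S↑@(_ ∷ S′↑) (l< ∷ L↑) p | inj₁ (here refl)
  with R , LR∈ , v↭ ← splits-complete S S′↑ L↑ (drop-∷ p)
  = R , Mem.∈-++⁺ˡ (Mem.∈-map⁺ _ LR∈) , v↭
splits-complete {L} {v} (x ∷ S) (_ ∷ S′↑) L↑ p | inj₂ x∈v
  with as , bs , refl ← Mem.∈-∃++ x∈v
  with R , LR∈ , v↭ ← splits-complete {v = as ++ bs} S S′↑ L↑
    (drop-∷ (↭-trans p (↭-trans (++⁺ˡ L (shift x as bs)) (shift x L (as ++ bs)))))
  = x ∷ R , Mem.∈-++⁺ʳ _ (Mem.∈-map⁺ _ LR∈) , ↭-trans (shift x as bs) (prep x v↭)

map-proj₁-splits : ∀ x S →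
  map proj₁ (splits (x ∷ S)) ≡ map (x ∷_) (map proj₁ (splits S)) ++ map proj₁ (splits S)
map-proj₁-splits x S = trans
  (List.map-++ proj₁ (map (map₁ (x ∷_)) (splits S)) _)
  (cong₂ _++_ (trans (sym (List.map-∘ (splits S))) (List.map-∘ (splits S)))
              (sym (List.map-∘ (splits S))))

-- A left part that takes `x` contains it; any other consists of letters of `S`, all different from
-- `x`.
unique-splits : ∀ S → Unique S → Unique (map proj₁ (splits S))
unique-splits []      _         = [] ∷ []
unique-splits (x ∷ S) (x∉ ∷ S!) rewrite map-proj₁-splits x S
  = Unique.++⁺ (Unique.map⁺ List.∷-injectiveʳ (unique-splits S S!)) (unique-splits S S!) disjoint
  where
  disjoint : ∀ {L} → ¬ (L ∈ map (x ∷_) (map proj₁ (splits S)) × L ∈ map proj₁ (splits S))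
  disjoint (p , q)
    with _ , _ , refl ← Mem.∈-map⁻ (x ∷_) p
    with _ , LR∈ , refl ← Mem.∈-map⁻ proj₁ q
    = contradiction refl (All.head (proj₁ (interleaving-all (splits⇒interleaving S LR∈) x∉)))

-- Pascal's rule: a letter sent to the left leaves the size of the right part as it is, and one sent
-- to the right raises it, which turns `g` into `g ∘ suc`.
sum-splits : (g : ℕ → ℕ) (S : List ℕ) →
  sum (map (g ∘ length ∘ proj₂) (splits S)) ≡ binomialTransform g (length S)
sum-splits g []      = +-identityʳ _
sum-splits g (x ∷ S) = begin
  sum (map h (map (map₁ (x ∷_)) (splits S) ++ map (map₂ (x ∷_)) (splits S)))
    ≡⟨ cong sum (List.map-++ h (map (map₁ (x ∷_)) (splits S)) _) ⟩
  sum (map h (map (map₁ (x ∷_)) (splits S)) ++ map h (map (map₂ (x ∷_)) (splits S)))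
    ≡⟨ sum-++ (map h (map (map₁ (x ∷_)) (splits S))) _ ⟩
  sum (map h (map (map₁ (x ∷_)) (splits S))) + sum (map h (map (map₂ (x ∷_)) (splits S)))
    ≡⟨ cong₂ (λ a b → sum a + sum b) (List.map-∘ (splits S)) (List.map-∘ (splits S)) ⟨
  sum (map h (splits S)) + sum (map (g ∘ suc ∘ length ∘ proj₂) (splits S))
    ≡⟨ cong₂ _+_ (sum-splits g S) (sum-splits (g ∘ suc) S) ⟩
  binomialTransform g (length (x ∷ S)) ∎
  where
  open ≡-Reasoning
  h : List ℕ × List ℕ → ℕ
  h = g ∘ length ∘ proj₂

-- The counterpart of `splits` for avoiders that begin with a descent: there the part in front of
-- the smallest letter is a single letter.
picks : List ℕ → List (ℕ × List ℕ)
picks []      = []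
picks (x ∷ S) = (x , S) ∷ map (map₂ (x ∷_)) (picks S)

picks⇒interleaving : ∀ S → (x , R) ∈ picks S → Interleaving (x ∷ []) R S
picks⇒interleaving (x ∷ S) (here refl) = consˡ (remaining S)
  where
  remaining : ∀ S → Interleaving [] S S
  remaining []      = []
  remaining (_ ∷ S) = consʳ (remaining S)
picks⇒interleaving (x ∷ S) (there xR∈)
  with _ , xR∈′ , refl ← Mem.∈-map⁻ _ xR∈ = consʳ (picks⇒interleaving S xR∈′)

map-proj₁-picks : ∀ S → map proj₁ (picks S) ≡ S
map-proj₁-picks []      = refl
map-proj₁-picks (x ∷ S) =
  cong (x ∷_) (trans (sym (List.map-∘ (picks S))) (map-proj₁-picks S))

picks-complete : x ∈ S → ∃ λ R → (x , R) ∈ picks S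
picks-complete (here refl) = _ , here refl
picks-complete (there x∈S) with _ , xR∈ ← picks-complete x∈S = _ , there (Mem.∈-map⁺ _ xR∈)

-- Avoidance of 32-1 on lists

-- Any descent serves as the 32 of the pattern, so avoidance only constrains
-- the letters after a descent bottom.
DescentBottomMinimal : ℕ → List ℕ → Set
DescentBottomMinimal x []      = ⊤
DescentBottomMinimal x (y ∷ v) = y < x → All (y ≤_) v

data Avoiding : List ℕ → Set where
  []  : Avoiding []
  _∷_ : DescentBottomMinimal x w → Avoiding w → Avoiding (x ∷ w)

avoiding-minimum-∷ : All (s ≤_) v → Avoiding v → Avoiding (s ∷ v)
avoiding-minimum-∷ []        []    = _ ∷ []
avoiding-minimum-∷ (s≤y ∷ _) v-av  = (λ y<s → contradiction s≤y (<⇒≱ y<s)) ∷ v-av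

avoiding-++-minimum : Increasing L → All (s ≤_) v → Avoiding v → Avoiding (L ++ s ∷ v)
avoiding-++-minimum []                     s≤v v-av = avoiding-minimum-∷ s≤v v-av
avoiding-++-minimum (_ ∷ [])               s≤v v-av = (λ _ → s≤v) ∷ avoiding-minimum-∷ s≤v v-av
avoiding-++-minimum ((x<y ∷ _) ∷ L↑@(_ ∷ _)) s≤v v-av =
  (λ y<x → contradiction y<x (<-asym x<y)) ∷ avoiding-++-minimum L↑ s≤v v-av

-- A descent inside `L` would have its bottom above the later letter `s`, which completes the
-- pattern. Without repeated letters, no descent means an ascent.
avoiding-++⇒increasing : ∀ L → All (s <_) L → Unique (L ++ s ∷ v) →
  Avoiding (L ++ s ∷ v) → Increasing L
avoiding-++⇒increasing []          _           _               _             = []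
avoiding-++⇒increasing (x ∷ [])    _           _               _             = [] ∷ []
avoiding-++⇒increasing (x ∷ y ∷ L) (_ ∷ s<L@(s<y ∷ _)) ((x≢y ∷ _) ∷ u) (bottom ∷ av)
  with y< ∷ L↑ ← avoiding-++⇒increasing (y ∷ L) s<L u av
  = (x<y ∷ All.map (<-trans x<y) y<) ∷ y< ∷ L↑
  where
  x<y : x < y
  x<y = ≤∧≢⇒< (≮⇒≥ λ y<x → contradiction s<y (≤⇒≯ (All.head (All.++⁻ʳ L (bottom y<x))))) x≢y

avoiding-++⇒tail : ∀ L → Avoiding (L ++ s ∷ v) → Avoiding v
avoiding-++⇒tail []      (_ ∷ v-av) = v-av
avoiding-++⇒tail (_ ∷ L) (_ ∷ av)   = avoiding-++⇒tail L av

-- Listing and counting the avoiders on a given set of letters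

around : ℕ → (List ℕ → List (List ℕ)) → List ℕ × List ℕ → List (List ℕ)
around s arrangements (L , R) = map (λ w → L ++ s ∷ w) (arrangements R)

-- The first argument bounds the length of the second, for the sake of
-- termination.
avoiders : ℕ → List ℕ → List (List ℕ)
avoiders _       []      = [] ∷ []
avoiders zero    (_ ∷ _) = []
avoiders (suc f) (s ∷ S) = concatMap (around s (avoiders f)) (splits S)

∈-avoiders⁻ : ∀ f s S → w ∈ avoiders (suc f) (s ∷ S) →
  ∃₂ λ L R → ∃ λ v → (L , R) ∈ splits S × v ∈ avoiders f R × w ≡ L ++ s ∷ v
∈-avoiders⁻ f s S w∈
  with (L , R) , LR∈ , w∈′ ← find (Mem.∈-concatMap⁻ (around s (avoiders f)) w∈)
  with v , v∈ , w≡ ← Mem.∈-map⁻ _ w∈′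
  = L , R , v , LR∈ , v∈ , w≡

avoiders-sound : ∀ f S → Increasing S → w ∈ avoiders f S → w ↭ S × Avoiding w
avoiders-sound zero    []      _         (here refl) = ↭-refl , []
avoiders-sound (suc f) []      _         (here refl) = ↭-refl , []
avoiders-sound (suc f) (s ∷ S) (s< ∷ S↑) w∈
  with L , R , v , LR∈ , v∈ , refl ← ∈-avoiders⁻ f s S w∈
  with sp ← splits⇒interleaving S LR∈
  with L↑ , R↑ ← interleaving-increasing sp S↑
  with v↭R , v-av ← avoiders-sound f R R↑ v∈
  = ↭-trans (shift s L v) (prep s (↭-trans (++⁺ˡ L v↭R) (↭-sym (toPermutation sp))))
  , avoiding-++-minimum L↑ (All-resp-↭ (↭-sym v↭R) (All.map <⇒≤ (proj₂ (interleaving-all sp s<)))) v-av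

avoiders-complete : ∀ f S → length S ≤ f → Increasing S → w ↭ S → Avoiding w → w ∈ avoiders f S
avoiders-complete zero    []      _       _  p _ with refl ← Perm.↭-empty-inv p = here refl
avoiders-complete (suc f) []      _       _  p _ with refl ← Perm.↭-empty-inv p = here refl
avoiders-complete (suc f) (s ∷ S) (s≤s S≤f) S↑@(s< ∷ S′↑) p av
  with L , v , refl ← Mem.∈-∃++ (∈-resp-↭ (↭-sym p) (here refl))
  with q ← drop-∷ (↭-trans (↭-sym (shift s L v)) p)
  with L↑ ← avoiding-++⇒increasing L (All.++⁻ˡ L (All-resp-↭ (↭-sym q) s<))
                (unique-resp-↭ (↭-sym p) (increasing⇒unique S↑)) av
  with R , LR∈ , v↭R ← splits-complete S S′↑ L↑ (↭-sym q)
  with sp ← splits⇒interleaving S LR∈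
  = Mem.∈-concatMap⁺ (around s (avoiders f)) (lose LR∈ (Mem.∈-map⁺ _ (avoiders-complete f R
      -- The right part is no longer than `S`, so the bound `f` still suffices for it.
      (≤-trans (interleaving-length≤ sp) S≤f)
      (proj₂ (interleaving-increasing sp S′↑)) v↭R (avoiding-++⇒tail L av))))

-- Both `us` and `us′` are the part in front of the first occurrence of `a`.
++-∷-cancelˡ : {a : A} {us vs us′ vs′ : List A} → a ∉ us → a ∉ us′ →
  us ++ a ∷ vs ≡ us′ ++ a ∷ vs′ → us ≡ us′
++-∷-cancelˡ {us = []}    {us′ = []}     _  _   _  = refl
++-∷-cancelˡ {us = []}    {us′ = _ ∷ _}  _  a∉′ eq = contradiction (here (List.∷-injectiveˡ eq)) a∉′
++-∷-cancelˡ {us = _ ∷ _} {us′ = []}     a∉ _   eq = contradiction (here (sym (List.∷-injectiveˡ eq))) a∉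
++-∷-cancelˡ {us = _ ∷ _} {us′ = _ ∷ _}  a∉ a∉′ eq =
  cong₂ _∷_ (List.∷-injectiveˡ eq) (++-∷-cancelˡ (a∉ ∘ there) (a∉′ ∘ there) (List.∷-injectiveʳ eq))

unique-avoiders : ∀ f S → Increasing S → Unique (avoiders f S)
unique-avoiders zero    []      _         = [] ∷ []
unique-avoiders zero    (_ ∷ _) _         = []
unique-avoiders (suc f) []      _         = [] ∷ []
unique-avoiders (suc f) (s ∷ S) (s< ∷ S↑) = unique-concatMap (around s (avoiders f)) proj₁ (splits S)
  (λ {(L , R)} LR∈ → Unique.map⁺ (List.∷-injectiveʳ ∘ List.++-cancelˡ L _ _)
    (unique-avoiders f R (proj₂ (interleaving-increasing (splits⇒interleaving S LR∈) S↑))))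
  same-left
  (unique-splits S (increasing⇒unique S↑))
  where
  s∉left : ∀ {L R} → (L , R) ∈ splits S → s ∉ L
  s∉left LR∈ s∈L =
    <-irrefl refl (All.lookup (proj₁ (interleaving-all (splits⇒interleaving S LR∈) s<)) s∈L)

  same-left : ∀ {(L , R) (L′ , R′) : List ℕ × List ℕ} {w} → (L , R) ∈ splits S → (L′ , R′) ∈ splits S →
    w ∈ map (λ w → L ++ s ∷ w) (avoiders f R) → w ∈ map (λ w → L′ ++ s ∷ w) (avoiders f R′) → L ≡ L′
  same-left {L , _} {L′ , _} LR∈ LR∈′ w∈ w∈′
    with _ , _ , refl ← Mem.∈-map⁻ (λ w → L ++ s ∷ w) w∈
    with _ , _ , eq ← Mem.∈-map⁻ (λ w → L′ ++ s ∷ w) w∈′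
    = ++-∷-cancelˡ (s∉left LR∈) (s∉left LR∈′) eq

length-avoiders : ∀ f S → length S ≤ f → length (avoiders f S) ≡ bell (length S)
length-avoiders zero    []      _         = refl
length-avoiders (suc f) []      _         = refl
length-avoiders (suc f) (s ∷ S) (s≤s S≤f) = begin
  length (avoiders (suc f) (s ∷ S))
    ≡⟨ length-concatMap _ (splits S) ⟩
  sum (map (length ∘ around s (avoiders f)) (splits S))
    -- The induction hypothesis needs a bound on the length of `R`, which comes from membership in
    -- `splits S`; hence the local form of congruence.
    ≡⟨ cong sum (List.map-cong-local {xs = splits S} (All.tabulate λ {(L , R)} LR∈ →
         trans (List.length-map _ (avoiders f R))
               (length-avoiders f R (≤-trans (interleaving-length≤ (splits⇒interleaving S LR∈)) S≤f)))) ⟩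
  sum (map (bell ∘ length ∘ proj₂) (splits S))
    ≡⟨ sum-splits bell S ⟩
  binomialTransform bell (length S)
    ≡⟨ bell-suc (length S) ⟨
  bell (length (s ∷ S)) ∎
  where open ≡-Reasoning

-- Avoiders beginning with an ascent

-- Words of fewer than two letters fall into the complement. Among words of distinct letters, the
-- complement means an initial descent only from length two on.
StartsAscending : List ℕ → Set
StartsAscending (x ∷ y ∷ _) = x < y
StartsAscending _           = ⊥

startsAscending? : Decidable StartsAscending
startsAscending? []          = no λ ()
startsAscending? (_ ∷ [])    = no λ ()
startsAscending? (x ∷ y ∷ _) = x <? y

ascendingAvoiders : ℕ → List ℕ → List (List ℕ)
ascendingAvoiders f S = filter startsAscending? (avoiders f S)

descendingAvoiders : ℕ → ℕ → List ℕ → List (List ℕ)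
descendingAvoiders f s S =
  concatMap (around s (avoiders f) ∘ map₁ [_]) (picks S)

-- The bottom lies below `x` by the descent and is at most every later letter by avoidance.
descent-bottom≡minimum : Increasing (s ∷ S) → x ∷ y ∷ v ↭ s ∷ S → y < x → Avoiding (x ∷ y ∷ v) → y ≡ s
descent-bottom≡minimum {s} {x = x} {y} {v} S↑ p y<x (bottom ∷ _) =
  ≤-antisym (y≤ (∈-resp-↭ (↭-sym p) (here refl)))
            (minimum-∈ S↑ (∈-resp-↭ p (there (here refl))))
  where
  y≤ : ∀ {z} → z ∈ x ∷ y ∷ v → y ≤ z
  y≤ (here refl)         = <⇒≤ y<x
  y≤ (there (here refl)) = ≤-refl
  y≤ (there (there z∈v)) = All.lookup (bottom y<x) z∈v

descendingAvoiders-sound : ∀ f s S → Increasing (s ∷ S) → w ∈ descendingAvoiders f s S →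
  w ↭ s ∷ S × Avoiding w × ¬ StartsAscending w
descendingAvoiders-sound f s S (s< ∷ S↑) w∈
  with (x , R) , xR∈ , w∈′ ← find (Mem.∈-concatMap⁻ (around s (avoiders f) ∘ map₁ [_]) {xs = picks S} w∈)
  with v , v∈ , refl ← Mem.∈-map⁻ _ w∈′
  with sp ← picks⇒interleaving S xR∈
  with s<x ∷ [] , s<R ← interleaving-all sp s<
  with v↭R , v-av ← avoiders-sound f R (proj₂ (interleaving-increasing sp S↑)) v∈
  = ↭-trans (↭-swap x s v↭R) (prep s (↭-sym (toPermutation sp)))
  , avoiding-++-minimum ([] ∷ []) (All-resp-↭ (↭-sym v↭R) (All.map <⇒≤ s<R)) v-av
  , <-asym s<x

descendingAvoiders-complete : ∀ f s S → 1 ≤ length S → length S ≤ suc f → Increasing (s ∷ S) →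
  w ↭ s ∷ S → Avoiding w → ¬ StartsAscending w → w ∈ descendingAvoiders f s S
descendingAvoiders-complete {w = []}        f s S _ _ _ p _ _ = contradiction (↭-length p) λ ()
descendingAvoiders-complete {w = _ ∷ []}    f s S 1≤ _ _ p _ _ =
  contradiction (suc-injective (↭-length p)) (<⇒≢ 1≤)
descendingAvoiders-complete {w = x ∷ y ∷ v} f s S _ S≤ S↑@(s< ∷ S′↑) p av@(_ ∷ _ ∷ v-av) x≮y
  with (x≢y ∷ _) ∷ _ ← unique-resp-↭ (↭-sym p) (increasing⇒unique S↑)
  -- The first two letters are distinct and do not ascend, so they form a descent.
  with refl ← descent-bottom≡minimum S↑ p (≤∧≢⇒< (≮⇒≥ x≮y) (x≢y ∘ sym)) av
  with q ← drop-∷ (↭-trans (↭-swap s x ↭-refl) p)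
  with R , xR∈ ← picks-complete (∈-resp-↭ q (here refl))
  with sp ← picks⇒interleaving S xR∈
  = Mem.∈-concatMap⁺ (around s (avoiders f) ∘ map₁ [_]) {xs = picks S} (lose xR∈ (Mem.∈-map⁺ _ (avoiders-complete f R
      (≤-pred (≤-trans (≤-reflexive (sym (interleaving-length sp))) S≤))
      (proj₂ (interleaving-increasing sp S′↑))
      (drop-∷ (↭-trans q (toPermutation sp))) v-av)))

unique-descendingAvoiders : ∀ f s S → Increasing S → Unique (descendingAvoiders f s S)
unique-descendingAvoiders f s S S↑ = unique-concatMap (around s (avoiders f) ∘ map₁ [_]) proj₁ (picks S)
  (λ {(x , R)} xR∈ → Unique.map⁺ (List.∷-injectiveʳ ∘ List.∷-injectiveʳ)
    (unique-avoiders f R (proj₂ (interleaving-increasing (picks⇒interleaving S xR∈) S↑))))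
  same-first
  (subst Unique (sym (map-proj₁-picks S)) (increasing⇒unique S↑))
  where
  same-first : ∀ {(x , R) (x′ , R′) : ℕ × List ℕ} {w} → (x , R) ∈ picks S → (x′ , R′) ∈ picks S →
    w ∈ map (λ w → x ∷ s ∷ w) (avoiders f R) → w ∈ map (λ w → x′ ∷ s ∷ w) (avoiders f R′) → x ≡ x′
  same-first _ _ w∈ w∈′
    with _ , _ , refl ← Mem.∈-map⁻ _ w∈
    with _ , _ , eq ← Mem.∈-map⁻ _ w∈′
    = List.∷-injectiveˡ eq

-- Each choice of the first letter leaves one letter fewer for the tail. For empty `S` both sides
-- vanish, so the truncated `length S ∸ 1` is harmless.
length-descendingAvoiders : ∀ f s S → length S ≤ suc f →
  length (descendingAvoiders f s S) ≡ length S · bell (length S ∸ 1)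
length-descendingAvoiders f s S S≤ = begin
  length (descendingAvoiders f s S)
    ≡⟨ length-concatMap _ (picks S) ⟩
  sum (map (length ∘ around s (avoiders f) ∘ map₁ [_]) (picks S))
    ≡⟨ cong sum (List.map-cong-local {xs = picks S} (All.tabulate λ {(x , R)} xR∈ →
         let eq = interleaving-length (picks⇒interleaving S xR∈) in
         trans (List.length-map _ (avoiders f R))
         (trans (length-avoiders f R (≤-pred (≤-trans (≤-reflexive (sym eq)) S≤)))
                (cong (bell ∘ (_∸ 1)) (sym eq))))) ⟩
  sum (map (λ _ → bell (length S ∸ 1)) (picks S))
    ≡⟨ sum-const _ (picks S) ⟩
  length (picks S) · bell (length S ∸ 1)
    ≡⟨ cong (_· bell (length S ∸ 1)) (trans (sym (List.length-map proj₁ (picks S))) (cong length (map-proj₁-picks S))) ⟩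
  length S · bell (length S ∸ 1) ∎
  where open ≡-Reasoning

-- With at least two letters, `descendingAvoiders f s S` has the same members as the complement of
-- the ascending avoiders, and neither list repeats a word. The additive form stays clear of
-- truncated subtraction.
length-ascendingAvoiders : ∀ f s S → 1 ≤ length S → length S ≤ f → Increasing (s ∷ S) →
  length (ascendingAvoiders (suc f) (s ∷ S)) + length S · bell (length S ∸ 1) ≡ bell (suc (length S))
length-ascendingAvoiders f s S 1≤ S≤f S↑ = begin
  length (ascendingAvoiders (suc f) (s ∷ S)) + length S · bell (length S ∸ 1)
    ≡⟨ cong (_+_ _) (length-descendingAvoiders f s S S≤) ⟨
  length (ascendingAvoiders (suc f) (s ∷ S)) + length (descendingAvoiders f s S)
    ≡⟨ cong (_+_ _) (unique-same-members⇒length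
         (unique-descendingAvoiders f s S (AllPairs.tail S↑))
         (Unique.filter⁺ _ (unique-avoiders (suc f) (s ∷ S) S↑))
         (λ w∈ → let p , av , ¬asc = descendingAvoiders-sound f s S S↑ w∈ in
           Mem.∈-filter⁺ _ (avoiders-complete (suc f) (s ∷ S) (s≤s S≤f) S↑ p av) ¬asc)
         (λ w∈ → let w∈′ , ¬asc = Mem.∈-filter⁻ (¬? ∘ startsAscending?) w∈
                     p , av = avoiders-sound (suc f) (s ∷ S) S↑ w∈′ in
           descendingAvoiders-complete f s S 1≤ S≤ S↑ p av ¬asc)) ⟩
  length (ascendingAvoiders (suc f) (s ∷ S)) + length (filter (¬? ∘ startsAscending?) (avoiders (suc f) (s ∷ S)))
    ≡⟨ length-filter-¬ startsAscending? (avoiders (suc f) (s ∷ S)) ⟩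
  length (avoiders (suc f) (s ∷ S))
    ≡⟨ length-avoiders (suc f) (s ∷ S) (s≤s S≤f) ⟩
  bell (suc (length S)) ∎
  where
  open ≡-Reasoning
  S≤ : length S ≤ suc f
  S≤ = m≤n⇒m≤1+n S≤f

-- From vectors to lists

range : ℕ → List ℕ
range n = map suc (upTo n)

increasing-range : ∀ n → Increasing (range n)
increasing-range n = AllPairs.map⁺ (AllPairs.applyUpTo⁺₁ id n (λ i<j _ → s≤s i<j))

length-range : ∀ n → length (range n) ≡ n
length-range n = trans (List.length-map suc (upTo n)) (List.length-upTo n)

∈-words⁺ : {as : List A} (π : Vec A n) → toList π ⊆ as → π ∈ words as n
∈-words⁺ []      _  = here refl
∈-words⁺ (a ∷ π) π⊆ =
  Mem.∈-cartesianProductWith⁺ _∷_ (π⊆ (here refl)) (∈-words⁺ π (π⊆ ∘ there))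

∈-words⁻ : {as : List A} (π : Vec A n) → π ∈ words as n → toList π ⊆ as
∈-words⁻ {as = as} (a ∷ π) π∈ p
  with _ , _ , a∈ , π∈′ , refl ← Mem.∈-cartesianProductWith⁻ _∷_ as (words as _) π∈
  with p
... | here refl = a∈
... | there p′  = ∈-words⁻ π π∈′ p′

unique-words : {as : List A} → Unique as → ∀ n → Unique (words as n)
unique-words as! zero    = [] ∷ []
unique-words as! (suc n) = Unique.cartesianProductWith⁺ _∷_ Vec.∷-injective as! (unique-words as! n)

unique-toList⁺ : {π : Vec A n} → Vec.Unique π → Unique (toList π)
unique-toList⁺ []       = []
unique-toList⁺ (a∉ ∷ u) = VecAll.toList⁺ a∉ ∷ unique-toList⁺ u

unique-toList⁻ : {π : Vec A n} → Unique (toList π) → Vec.Unique π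
unique-toList⁻ {π = []}    []       = []
unique-toList⁻ {π = _ ∷ _} (a∉ ∷ u) = VecAll.toList⁻ a∉ ∷ unique-toList⁻ u

∈-permutations⁺ : (π : Vec ℕ n) → toList π ↭ range n → π ∈ permutations n
∈-permutations⁺ {n} π p = Mem.∈-filter⁺ unique? (∈-words⁺ π (∈-resp-↭ p))
  (unique-toList⁻ (unique-resp-↭ (↭-sym p) (increasing⇒unique (increasing-range n))))

-- Pigeonhole: `n` distinct letters out of `n` use up all of them.
∈-permutations⁻ : (π : Vec ℕ n) → π ∈ permutations n → toList π ↭ range n
∈-permutations⁻ {n} π π∈ with π∈words , π! ← Mem.∈-filter⁻ unique? π∈ =
  unique-⊆-length⇒↭ (unique-toList⁺ π!) (∈-words⁻ π π∈words)
    (trans (Vec.length-toList π) (sym (length-range n)))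

-- If the new first letters lie strictly on the same side of corresponding later letters, asymmetry
-- settles the comparisons in both directions. Small patterns are then checked letter by letter.
orderIsomorphic-∷ : ∀ {k a b} {u v : Vec ℕ k} →
  (∀ j → (a < lookup u j × b < lookup v j) ⊎ (lookup u j < a × lookup v j < b)) →
  OrderIsomorphic u v → OrderIsomorphic (a ∷ u) (b ∷ v)
orderIsomorphic-∷ side iso zero    zero    = mk⇔ (⊥-elim ∘ <-irrefl refl) (⊥-elim ∘ <-irrefl refl)
orderIsomorphic-∷ side iso (suc i) (suc j) = iso i j
orderIsomorphic-∷ side iso zero    (suc j) with side j
... | inj₁ (a<  , b< ) = mk⇔ (λ _ → b<) (λ _ → a<)
... | inj₂ (a>  , b> ) = mk⇔ (⊥-elim ∘ <-asym a>) (⊥-elim ∘ <-asym b>)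
orderIsomorphic-∷ side iso (suc i) zero    with side i
... | inj₁ (a<  , b< ) = mk⇔ (⊥-elim ∘ <-asym a<) (⊥-elim ∘ <-asym b<)
... | inj₂ (a>  , b> ) = mk⇔ (λ _ → b>) (λ _ → a>)

orderIsomorphic-1⁺ : ∀ {a b} → OrderIsomorphic (a ∷ []) (b ∷ [])
orderIsomorphic-1⁺ = orderIsomorphic-∷ (λ ()) (λ ())

orderIsomorphic-12⁺ : ∀ {a b} → a < b → OrderIsomorphic (a ∷ b ∷ []) (1 ∷ 2 ∷ [])
orderIsomorphic-12⁺ a<b =
  orderIsomorphic-∷ (λ { zero → inj₁ (a<b , from-yes (1 <? 2)) }) orderIsomorphic-1⁺

orderIsomorphic-213⁺ : ∀ {a b c} → b < a → a < c →
  OrderIsomorphic (a ∷ b ∷ c ∷ []) (2 ∷ 1 ∷ 3 ∷ [])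
orderIsomorphic-213⁺ b<a a<c = orderIsomorphic-∷
  (λ { zero       → inj₂ (b<a , from-yes (1 <? 2))
     ; (suc zero) → inj₁ (a<c , from-yes (2 <? 3)) })
  (orderIsomorphic-∷ (λ { zero → inj₁ (<-trans b<a a<c , from-yes (1 <? 3)) }) orderIsomorphic-1⁺)

orderIsomorphic-321⁺ : ∀ {a b c} → b < a → c < b →
  OrderIsomorphic (a ∷ b ∷ c ∷ []) (3 ∷ 2 ∷ 1 ∷ [])
orderIsomorphic-321⁺ b<a c<b = orderIsomorphic-∷
  (λ { zero       → inj₂ (b<a , from-yes (2 <? 3))
     ; (suc zero) → inj₂ (<-trans c<b b<a , from-yes (1 <? 3)) })
  (orderIsomorphic-∷ (λ { zero → inj₂ (c<b , from-yes (1 <? 2)) }) orderIsomorphic-1⁺)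

-- Agreement of the two notions of avoidance, and the count as the length of a list

contains-∷ : (π : Vec ℕ n) → Contains32-1 π → Contains32-1 (x ∷ π)
contains-∷ π (i , i′ , j , adjacent , i′<j , iso) =
  suc i , suc i′ , suc j , cong suc adjacent , s≤s i′<j , iso

avoids⇒avoiding : (π : Vec ℕ n) → Avoids32-1 π → Avoiding (toList π)
avoids⇒avoiding []          _  = []
avoids⇒avoiding (x ∷ [])    _  = _ ∷ []
avoids⇒avoiding (x ∷ y ∷ π) av =
  (λ y<x → VecAll.toList⁺ (VecAll.lookup⁻ λ j → ≮⇒≥ λ z<y →
     av (zero , suc zero , suc (suc j) , refl , s≤s (s≤s z≤n) , orderIsomorphic-321⁺ y<x z<y)))
  ∷ avoids⇒avoiding (y ∷ π) (av ∘ contains-∷ (y ∷ π))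

avoiding⇒avoids : (π : Vec ℕ n) → Avoiding (toList π) → Avoids32-1 π
avoiding⇒avoids (x ∷ y ∷ π) (bottom ∷ _) (zero , suc zero , suc (suc j) , _ , _ , iso) =
  <⇒≱ (Equivalence.from (iso (suc (suc zero)) (suc zero)) (from-yes (1 <? 2)))
      (VecAll.lookup⁺ (VecAll.toList⁻ (bottom (Equivalence.from (iso (suc zero) zero) (from-yes (2 <? 3))))) j)
avoiding⇒avoids (x ∷ π) (_ ∷ av) (suc i , suc i′ , suc j , adjacent , s≤s i′<j , iso) =
  avoiding⇒avoids π av (i , i′ , j , suc-injective adjacent , i′<j , iso)
-- The remaining index triples are void: `j` has to come after `i′`, and `i′` directly after `i`.
avoiding⇒avoids (x ∷ y ∷ π) _ (zero , suc zero , suc zero , _ , s≤s () , _)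
avoiding⇒avoids (x ∷ π) _ (zero , suc (suc _) , _ , () , _ , _)

-- Neither `E` nor the list of counted permutations has repetitions, so it suffices to compare
-- members. The condition on lengths allows a word of `E` to be read back as a vector.
N≡length : ∀ {k} (p : Vec ℕ k) (E : List (List ℕ)) → Unique E →
  (∀ {w} → w ∈ E → length w ≡ n) →
  (∀ π → toList π ↭ range n → Avoiding (toList π) → BeginsWith p π → toList π ∈ E) →
  (∀ π → toList π ∈ E → toList π ↭ range n × Avoiding (toList π) × BeginsWith p π) →
  N p n ≡ length E
N≡length {n} p E E! length-E to from = begin
  N p n                     ≡⟨ List.length-map toList Π ⟨
  length (map toList Π)     ≡⟨ unique-same-members⇒length
    (Unique.map⁺ toList-injective (Unique.filter⁺ _ (Unique.filter⁺ unique?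
      (unique-words (increasing⇒unique (increasing-range n)) n)))) E! Π⊆E E⊆Π ⟩
  length E                  ∎
  where
  open ≡-Reasoning
  Π : List (Vec ℕ n)
  Π = filter (λ π → avoids32-1? π ×-dec beginsWith? p π) (permutations n)

  toList-injective : ∀ {π ρ : Vec ℕ n} → toList π ≡ toList ρ → π ≡ ρ
  toList-injective {π} {ρ} eq =
    trans (sym (Vec.cast-is-id refl π)) (Vec.toList-injective refl π ρ eq)

  Π⊆E : map toList Π ⊆ E
  Π⊆E w∈
    with π , π∈ , refl ← Mem.∈-map⁻ toList w∈
    with π∈perm , av , begins ← Mem.∈-filter⁻ (λ π → avoids32-1? π ×-dec beginsWith? p π) {xs = permutations n} π∈
    = to π (∈-permutations⁻ π π∈perm) (avoids⇒avoiding π av) begins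

  E⊆Π : E ⊆ map toList Π
  E⊆Π {w} w∈ = subst (_∈ map toList Π) π≡w (Mem.∈-map⁺ toList
    (let perm , av , begins = from π (subst (_∈ E) (sym π≡w) w∈) in
     Mem.∈-filter⁺ _ (∈-permutations⁺ π perm) (avoiding⇒avoids π av , begins)))
    where
    π : Vec ℕ n
    π = Vec.cast (length-E w∈) (Vec.fromList w)
    π≡w : toList π ≡ w
    π≡w = trans (Vec.toList-cast (length-E w∈) (Vec.fromList w)) (Vec.toList∘fromList w)

-- The four cases of the leading pattern

∈-avoiders-range⁺ : ∀ n → w ↭ range n → Avoiding w → w ∈ avoiders n (range n)
∈-avoiders-range⁺ n =
  avoiders-complete n (range n) (≤-reflexive (length-range n)) (increasing-range n)

∈-avoiders-range⁻ : ∀ n → w ∈ avoiders n (range n) → w ↭ range n × Avoiding w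
∈-avoiders-range⁻ n = avoiders-sound n (range n) (increasing-range n)

↭-range⇒length : w ↭ range n → length w ≡ n
↭-range⇒length {n = n} p = trans (↭-length p) (length-range n)

N-1 : 1 ≤ n → N (leadingPattern 1) n ≡ bell n
N-1 {n} 1≤n = begin
  N (leadingPattern 1) n       ≡⟨ N≡length (leadingPattern 1) (avoiders n (range n))
    (unique-avoiders n (range n) (increasing-range n))
    (↭-range⇒length ∘ proj₁ ∘ ∈-avoiders-range⁻ n)
    (λ π p av _ → ∈-avoiders-range⁺ n p av)
    (λ π π∈ → let p , av = ∈-avoiders-range⁻ n π∈ in p , av , begins 1≤n π) ⟩
  length (avoiders n (range n)) ≡⟨ length-avoiders n (range n) (≤-reflexive (length-range n)) ⟩
  bell (length (range n))      ≡⟨ cong bell (length-range n) ⟩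
  bell n                       ∎
  where
  open ≡-Reasoning
  begins : ∀ {n} → 1 ≤ n → (π : Vec ℕ n) → BeginsWith (leadingPattern 1) π
  begins (s≤s z≤n) (_ ∷ _) = s≤s z≤n , orderIsomorphic-1⁺

-- range (suc n) is 1 ∷ tailRange n.
tailRange : ℕ → List ℕ
tailRange n = map suc (applyUpTo suc n)

length-tailRange : ∀ n → length (tailRange n) ≡ n
length-tailRange n = trans (List.length-map suc (applyUpTo suc n)) (List.length-applyUpTo suc n)

N-12≡length : ∀ n →
  N (leadingPattern 2) (2 + n) ≡ length (ascendingAvoiders (2 + n) (range (2 + n)))
N-12≡length n = N≡length (leadingPattern 2) _
  (Unique.filter⁺ _ (unique-avoiders m (range m) (increasing-range m)))
  (λ w∈ → ↭-range⇒length (proj₁ (∈-avoiders-range⁻ m (proj₁ (Mem.∈-filter⁻ startsAscending? w∈)))))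
  (λ { π@(_ ∷ _ ∷ _) p av (s≤s (s≤s z≤n) , iso) →
       Mem.∈-filter⁺ startsAscending? (∈-avoiders-range⁺ m p av)
         (Equivalence.from (iso zero (suc zero)) (from-yes (1 <? 2))) })
  (λ { π@(_ ∷ _ ∷ _) π∈ →
       let π∈′ , asc = Mem.∈-filter⁻ startsAscending? π∈
           p , av = ∈-avoiders-range⁻ m π∈′
       in p , av , s≤s (s≤s z≤n) , orderIsomorphic-12⁺ asc })
  where
  m = 2 + n

N-12 : ∀ n → N (leadingPattern 2) (2 + n) + suc n · bell n ≡ bell (2 + n)
N-12 n = begin
  N (leadingPattern 2) (2 + n) + suc n · bell n
    -- The smallest letter is 1, and `T` consists of the `suc n` letters above it.
    ≡⟨ cong₂ (λ a l → a + l · bell (l ∸ 1)) (N-12≡length n) (sym (length-tailRange (suc n))) ⟩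
  length (ascendingAvoiders (2 + n) (range (2 + n))) + length T · bell (length T ∸ 1)
    ≡⟨ length-ascendingAvoiders (suc n) 1 T (s≤s z≤n) (≤-reflexive (length-tailRange (suc n)))
         (increasing-range (2 + n)) ⟩
  bell (suc (length T))
    ≡⟨ cong (bell ∘ suc) (length-tailRange (suc n)) ⟩
  bell (2 + n) ∎
  where
  open ≡-Reasoning
  T : List ℕ
  T = tailRange (suc n)

-- The value at the empty list is a default that keeps the map injective; the words of interest have
-- at least two letters.
insertSecond : A → List A → List A
insertSecond b []      = b ∷ []
insertSecond b (x ∷ v) = x ∷ b ∷ v

insertSecond-injective : {b : A} {v w : List A} → insertSecond b v ≡ insertSecond b w → v ≡ w
insertSecond-injective {v = []}    {[]}    _    = refl
insertSecond-injective {v = _ ∷ _} {_ ∷ _} refl = refl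

-- Deleting the letter 1 in second position turns an avoider beginning with 213
-- into an avoider on the remaining letters beginning with an ascent.
N-213≡length : ∀ n →
  N (leadingPattern 3) (3 + n) ≡ length (ascendingAvoiders (2 + n) (tailRange (2 + n)))
N-213≡length n = trans
  (N≡length (leadingPattern 3) (map (insertSecond 1) E)
    (Unique.map⁺ insertSecond-injective (Unique.filter⁺ _ (unique-avoiders m T T↑)))
    length-E
    to
    from)
  (List.length-map (insertSecond 1) E)
  where
  m = 2 + n
  T : List ℕ
  T = tailRange m
  E = ascendingAvoiders m T

  T↑ : Increasing T
  T↑ = AllPairs.tail (increasing-range (suc m))

  1<T : All (1 <_) T
  1<T = AllPairs.head (increasing-range (suc m))

  members : ∀ {w} → w ∈ map (insertSecond 1) E → ∃₂ λ x y → ∃ λ v →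
    w ≡ x ∷ 1 ∷ y ∷ v × x ∷ y ∷ v ↭ T × Avoiding (x ∷ y ∷ v) × x < y
  members w∈ with Mem.∈-map⁻ (insertSecond 1) w∈
  ... | w′ , w′∈ , refl with Mem.∈-filter⁻ startsAscending? {xs = avoiders m T} w′∈
  ... | w′∈′ , asc with avoiders-sound m T T↑ w′∈′
  members w∈ | x ∷ y ∷ v , _ , refl | _ , x<y | p , av = x , y , v , refl , p , av , x<y

  length-E : ∀ {w} → w ∈ map (insertSecond 1) E → length w ≡ suc m
  length-E w∈ with _ , _ , _ , refl , p , _ ← members w∈ =
    cong suc (trans (↭-length p) (length-tailRange m))

  to : ∀ π → toList π ↭ range (suc m) → Avoiding (toList π) → BeginsWith (leadingPattern 3) π →
    toList π ∈ map (insertSecond 1) E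
  to (x ∷ b ∷ y ∷ π) p av@(_ ∷ _ ∷ yπ-av) (s≤s (s≤s (s≤s z≤n)) , iso)
    with b<x ← Equivalence.from (iso (suc zero) zero) (from-yes (1 <? 2))
    with x<y ← Equivalence.from (iso zero (suc (suc zero))) (from-yes (2 <? 3))
    -- The pattern 213 opens with a descent, so the second letter is the smallest one, 1.
    with refl ← descent-bottom≡minimum (increasing-range (suc m)) p b<x av
    = Mem.∈-map⁺ (insertSecond 1) {x = x ∷ y ∷ toList π} (Mem.∈-filter⁺ startsAscending?
        (avoiders-complete m T (≤-reflexive (length-tailRange m)) T↑
          (drop-∷ (↭-trans (↭-swap 1 x ↭-refl) p))
          ((λ y<x → contradiction y<x (<-asym x<y)) ∷ yπ-av))
        x<y)

  from : ∀ π → toList π ∈ map (insertSecond 1) E →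
    toList π ↭ range (suc m) × Avoiding (toList π) × BeginsWith (leadingPattern 3) π
  from (_ ∷ _ ∷ _ ∷ π) π∈
    with x , y , _ , refl , p , _ ∷ yπ-av , x<y ← members π∈
    -- All other letters exceed 1, so the new descent into 1 cannot take part in the pattern.
    with 1<x ∷ 1<yπ ← All-resp-↭ (↭-sym p) 1<T
    = ↭-trans (↭-swap x 1 ↭-refl) (prep 1 p)
    , avoiding-++-minimum ([] ∷ []) (All.map <⇒≤ 1<yπ) yπ-av
    , s≤s (s≤s (s≤s z≤n)) , orderIsomorphic-213⁺ 1<x x<y

-- Without the letter 1 there remain `2 + n` letters with minimum 2, as many as in `N-12`; hence the
-- same right-hand side for words one letter longer.
N-213 : ∀ n → N (leadingPattern 3) (3 + n) + suc n · bell n ≡ bell (2 + n)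
N-213 n = begin
  N (leadingPattern 3) (3 + n) + suc n · bell n
    ≡⟨ cong₂ (λ a l → a + l · bell (l ∸ 1)) (N-213≡length n) (sym length-T) ⟩
  length (ascendingAvoiders (2 + n) (2 ∷ T)) + length T · bell (length T ∸ 1)
    ≡⟨ length-ascendingAvoiders (suc n) 2 T (s≤s z≤n) (≤-reflexive length-T)
         (AllPairs.tail (increasing-range (3 + n))) ⟩
  bell (suc (length T))
    ≡⟨ cong (bell ∘ suc) length-T ⟩
  bell (2 + n) ∎
  where
  open ≡-Reasoning
  T : List ℕ
  T = map suc (applyUpTo (λ i → 2 + i) (suc n))

  length-T : length T ≡ suc n
  length-T = suc-injective (length-tailRange (2 + n))

-- The first three letters of the pattern decrease, so a word beginning with it has a third letter
-- below the bottom of its initial descent.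
N-4+ : ∀ m n → N (leadingPattern (4 + m)) n ≡ 0
N-4+ m n = N≡length {n} (leadingPattern (4 + m)) [] [] (λ ())
  (λ { (_ ∷ _ ∷ _ ∷ _ ∷ _) _ (bottom ∷ _) (s≤s (s≤s (s≤s (s≤s _))) , iso) →
       -- `≤-refl` serves because consecutive letters of the decreasing run differ by one.
       contradiction (All.head (bottom (Equivalence.from (iso (suc zero) zero) ≤-refl)))
         (<⇒≱ (Equivalence.from (iso (suc (suc zero)) (suc zero)) ≤-refl)) })
  (λ _ ())

+≡⇒≡- : ∀ a b c {d} → a + c · b ≡ d → + a ≡ + d - + c * + b
+≡⇒≡- a b c refl = sym (begin
  + (a + c · b) - + c * + b    ≡⟨ cong (+ (a + c · b) -_) (ℤ.pos-* c b) ⟨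
  + (a + c · b) - + (c · b)    ≡⟨ ℤ.m-n≡m⊖n (a + c · b) (c · b) ⟩
  (a + c · b) ⊖ (c · b)        ≡⟨ ℤ.⊖-≥ (m≤n+m (c · b) a) ⟩
  + (a + c · b ∸ c · b)        ≡⟨ cong +_ (m+n∸n≡m a (c · b)) ⟩
  + a                          ∎)
  where open ≡-Reasoning

proposition21 : (k n : ℕ) → 1 ≤ k → 1 ≤ n →
    (4 ≤ k → N (leadingPattern k) n ≡ 0) ×
    (k ≡ 3 → 3 ≤ n → + N (leadingPattern k) n ≡ + bell (n ∸ 1) - + (n ∸ 2) * + bell (n ∸ 3)) ×
    (k ≡ 2 → 2 ≤ n → + N (leadingPattern k) n ≡ + bell n - + (n ∸ 1) * + bell (n ∸ 2)) ×
    (k ≡ 1 → N (leadingPattern k) n ≡ bell n)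
proposition21 k n _ 1≤n =
    (λ { (s≤s (s≤s (s≤s (s≤s {n = m} _)))) → N-4+ m n })
  -- Here `n` is `3 + m`, so the truncated differences in the formula reduce to `2 + m`, `suc m` and
  -- `m`.
  , (λ { refl (s≤s (s≤s (s≤s {n = m} _))) → +≡⇒≡- _ (bell m) (suc m) (N-213 m) })
  , (λ { refl (s≤s (s≤s {n = m} _)) → +≡⇒≡- _ (bell m) (suc m) (N-12 m) })
  , (λ { refl → N-1 1≤n })
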